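{- Let $G$ be any graph with $N$ nodes and maximum node degree $\Delta$, and let $\ell_1,\ldots,\ell_d$ be positive integers with $\prod_{i=1}^d \ell_i\ge N$. Then $G$ can be embedded into the $d$-dimensional $\ell_1\times\cdots\times\ell_d$-grid with dilation at most $2\sum_{i=1}^d \ell_i$ and edge-congestion at most $2\lceil \Delta/2\rceil\cdot\max_{1\le i\le d}\ell_i$ (by a single embedding achieving both bounds).
   Context: Guest graphs are finite, simple and undirected. Write $[\ell]=\{1,\ldots,\ell\}$. The $d$-dimensional $\ell_1\times\cdots\times\ell_d$-grid is the graph with node set $\prod_{i=1}^d[\ell_i]$ in which two nodes are adjacent iff they differ in exactly one coordinate, and there by exactly $1$. An embedding of a graph $G$ into a graph $H$ is a pair $\langle\phi,\rho\rangle$ where $\phi:V(G)\to V(H)$ is injective and $\rho$ assigns to each edge $(u,v)$ of $G$ the edge set of a path in $H$ connecting $\phi(u)$ and $\phi(v)$. Its dilation is the maximum, over edges of $G$, of the number of edges of the assigned path. Its edge-congestion is the maximum, over edges $e'$ of $H$, of the number of edges of $G$ whose assigned path contains $e'$. -}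

module Defs where

open import Data.Fin as Fin using (Fin; toℕ)
import Data.Fin.Properties as Fin
open import Data.List
  using (List; []; _∷_; length; map; filter; mapMaybe; cartesianProduct; allFin)
open import Data.List.Extrema.Nat using (max)
open import Data.List.Relation.Unary.Any as Any using (Any)
open import Data.List.Relation.Unary.Unique.Propositional using (Unique)
open import Data.Maybe using (Maybe; just; nothing)
open import Data.Nat as ℕ using (ℕ; ∣_-_∣)
open import Data.Nat.ListAction using (product)
import Data.Nat.Properties as ℕ
open import Data.Product using (_×_; _,_; Σ-syntax)
open import Data.Product.Function.NonDependent.Propositional using (_×-↔_)
open import Data.Sum using (_⊎_)
open import Data.Unit using (⊤; tt)
open import Data.Vec using (Vec; []; _∷_; toList)
open import Data.Vec.Relation.Unary.All using (All; []; _∷_)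
open import Data.Vec.Relation.Unary.All.Properties using (lookup⁺)
open import Function using (_↔_; mk↔ₛ′; Inverse; Injective)
open import Function.Construct.Composition using (_↔-∘_)
open import Function.Construct.Identity using (↔-id)
open import Function.Construct.Symmetry using (↔-sym)
open import Function.Properties.Inverse using (↔⇒↣)
open import Level using (0ℓ)
open import Relation.Binary using (Rel; Decidable; DecidableEquality; Symmetric)
open import Relation.Binary.Construct.Closure.ReflexiveTransitive using (Star; ε; _◅_)
open import Relation.Binary.PropositionalEquality
  using (_≡_; _≢_; refl; sym; trans)
open import Relation.Nullary using (¬_; Dec; yes; no)
open import Relation.Nullary.Decidable
  using (_×-dec_; _⊎-dec_; _→-dec_; ¬?; via-injection)

record Graph : Set₁ where
  infix 4 _~_ _~?_ _≟_
  field
    Node     : Set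
    order    : ℕ
    indexing : Node ↔ Fin order
    _~_      : Rel Node 0ℓ
    _~?_     : Decidable _~_
    ~-sym    : Symmetric _~_
    ~-irrefl : ∀ {v} → ¬ (v ~ v)

  index : Node → Fin order
  index = Inverse.to indexing

  nodes : List Node
  nodes = map (Inverse.from indexing) (allFin order)

  _≟_ : DecidableEquality Node
  _≟_ = via-injection (↔⇒↣ indexing) Fin._≟_

  degree : Node → ℕ
  degree v = length (filter (v ~?_) nodes)

  maxDegree : ℕ
  maxDegree = max 0 (map degree nodes)

  -- Every undirected edge is represented once, with its endpoint of smaller
  -- index first; the proofs are irrelevant, so an edge is determined by its
  -- endpoints.
  record Edge : Set where
    constructor mkEdge
    field
      source target : Node
      .ordered      : index source Fin.< index target
      .adjacent     : source ~ target

  open Edge public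

  edge? : Node × Node → Maybe Edge
  edge? (u , v) with index u Fin.<? index v | u ~? v
  ... | yes u<v | yes u~v = just (mkEdge u v u<v u~v)
  ... | _       | _       = nothing

  edges : List Edge
  edges = mapMaybe edge? (cartesianProduct nodes nodes)

  visited : ∀ {u v} → Star _~_ u v → List Node
  visited {u} ε       = u ∷ []
  visited {u} (_ ◅ w) = u ∷ visited w

  steps : ∀ {u v} → Star _~_ u v → List (Node × Node)
  steps ε                 = []
  steps (_◅_ {u} {v} _ w) = (u , v) ∷ steps w

  record Path (u v : Node) : Set where
    constructor mkPath
    field
      walk   : Star _~_ u v
      simple : Unique (visited walk)

  pathLength : ∀ {u v} → Path u v → ℕ
  pathLength p = length (steps (Path.walk p))

  Traverses : Edge → Node × Node → Set
  Traverses e (x , y) = (x ≡ source e × y ≡ target e) ⊎ (x ≡ target e × y ≡ source e)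

  _∈ₚ_ : ∀ {u v} → Edge → Path u v → Set
  e ∈ₚ p = Any (Traverses e) (steps (Path.walk p))

  _∈ₚ?_ : ∀ {u v} (e : Edge) (p : Path u v) → Dec (e ∈ₚ p)
  e ∈ₚ? p = Any.any? traverses? (steps (Path.walk p))
    where
    traverses? : ∀ s → Dec (Traverses e s)
    traverses? (x , y) =
      (x ≟ source e ×-dec y ≟ target e) ⊎-dec (x ≟ target e ×-dec y ≟ source e)

-- A path determines its edge set, so ρ returns the path itself.
record Embedding (G H : Graph) : Set where
  private
    module G = Graph G
    module H = Graph H
  field
    φ           : G.Node → H.Node
    φ-injective : Injective _≡_ _≡_ φ
    ρ           : (e : G.Edge) → H.Path (φ (G.source e)) (φ (G.target e))

  dilation : ℕ
  dilation = max 0 (map (λ e → H.pathLength (ρ e)) G.edges)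

  congestionAt : H.Edge → ℕ
  congestionAt e′ = length (filter (λ e → e′ H.∈ₚ? ρ e) G.edges)

  edgeCongestion : ℕ
  edgeCongestion = max 0 (map congestionAt H.edges)

-- Coordinate i ranges over Fin ℓᵢ, i.e. over 0,…,ℓᵢ-1 rather than 1,…,ℓᵢ.
GridNode : ∀ {d} → Vec ℕ d → Set
GridNode ℓ = All Fin ℓ

module _ {d} {ℓ : Vec ℕ d} where

  coord : GridNode ℓ → Fin d → ℕ
  coord x i = toℕ (lookup⁺ x i)

  GridAdjacent : Rel (GridNode ℓ) 0ℓ
  GridAdjacent x y =
    Σ[ i ∈ Fin d ] (∣ coord x i - coord y i ∣ ≡ 1 × (∀ j → j ≢ i → coord x j ≡ coord y j))

  gridAdjacent? : Decidable GridAdjacent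
  gridAdjacent? x y = Fin.any? λ i →
    (∣ coord x i - coord y i ∣ ℕ.≟ 1) ×-dec
    Fin.all? λ j → ¬? (j Fin.≟ i) →-dec (coord x j ℕ.≟ coord y j)

  gridAdjacent-sym : Symmetric GridAdjacent
  gridAdjacent-sym {x} {y} (i , p , q) =
    i , trans (ℕ.∣-∣-comm (coord y i) (coord x i)) p , λ j j≢i → sym (q j j≢i)

  gridAdjacent-irrefl : ∀ {x} → ¬ GridAdjacent x x
  gridAdjacent-irrefl {x} (i , p , _) with trans (sym (ℕ.∣n-n∣≡0 (coord x i))) p
  ... | ()

gridIndexing : ∀ {d} (ℓ : Vec ℕ d) → GridNode ℓ ↔ Fin (product (toList ℓ))
gridIndexing []      = ↔-sym Fin.1↔⊤ ↔-∘ nil↔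
  where
  nil↔ : GridNode [] ↔ ⊤
  nil↔ = mk↔ₛ′ (λ _ → tt) (λ _ → []) (λ _ → refl) (λ { [] → refl })
gridIndexing (n ∷ ℓ) = ↔-sym Fin.*↔× ↔-∘ ((↔-id (Fin n) ×-↔ gridIndexing ℓ) ↔-∘ uncons↔)
  where
  uncons↔ : GridNode (n ∷ ℓ) ↔ (Fin n × GridNode ℓ)
  uncons↔ = mk↔ₛ′ (λ { (x ∷ xs) → x , xs }) (λ (x , xs) → x ∷ xs)
                  (λ _ → refl) (λ { (_ ∷ _) → refl })

grid : ∀ {d} → Vec ℕ d → Graph
grid ℓ = record
  { Node     = GridNode ℓ
  ; order    = product (toList ℓ)
  ; indexing = gridIndexing ℓ
  ; _~_      = GridAdjacent
  ; _~?_     = gridAdjacent?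
  ; ~-sym    = λ {x} {y} → gridAdjacent-sym {x = x} {y}
  ; ~-irrefl = λ {x} → gridAdjacent-irrefl {x = x}
  }

{-# OPTIONS --safe #-}

-- Orient the edges of G so that every node has at most k = ⌈Δ/2⌉ outgoing and at most k
-- incoming edges (a proper 2-colouring of the half-edges, as in Euler tours), and place
-- the nodes of G arbitrarily.  The edges are then messages with at most k of them per
-- source and per target.  They are routed one dimension at a time as in a Beneš network:
-- forgetting the first coordinate turns the messages into the edges of a bipartite
-- multigraph between residual positions, and splitting every position into k copies makes
-- its degree at most ℓ₁, so by König's theorem it has a proper colouring by ℓ₁ rows.  A
-- message moves along its first line to the row of its colour, is routed inductively
-- inside that row, and moves to its target along a last line.  A line carries at most
-- k ℓ₁ messages in the first phase and as many in the last, and the two phases cost fewer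
-- than 2 ℓ₁ steps.  Erasing loops turns walks into paths without increasing either bound.

module Submission where

open import Defs
open import Data.List.Extrema.Nat using (max)
open import Data.Nat using (ℕ; _*_; _≤_; _<_; ⌈_/2⌉)
open import Data.Nat.ListAction using (product; sum)
open import Data.Product using (Σ-syntax; _×_)
open import Data.Vec using (Vec; toList)
open import Data.Vec.Relation.Unary.All using (All)
open import Relation.Binary.PropositionalEquality using (_≡_)

open import Data.Bool using (Bool; true; false; not; if_then_else_)
open import Data.Bool.Properties as Bool using (not-¬; ¬-not; not-involutive)
open import Data.Empty using (⊥-elim-irr)
open import Data.Fin as Fin using (Fin; zero; suc; toℕ)
import Data.Fin.Properties as Fin
open import Data.List as List
  using (List; []; _∷_; length; filter; map; mapMaybe; cartesianProduct; _++_)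
open import Data.List.Extrema.Nat using (max≤v⁺; xs≤max)
open import Data.List.Membership.Propositional using (_∈_; find; lose)
open import Data.List.Membership.Propositional.Properties
  using (∈-map⁺; ∈-allFin; ∈-lookup; ∈-filter⁺; ∈-filter⁻; ∈-cartesianProduct⁺)
open import Data.List.Properties using (length-++; length-filter)
import Data.List.Relation.Unary.All as ListAll
import Data.List.Relation.Unary.All.Properties as ListAll
open import Data.List.Relation.Unary.AllPairs using ([]; _∷_)
open import Data.List.Relation.Unary.Any as Any using (Any; here; there)
import Data.List.Relation.Unary.Any.Properties as Any
open import Data.List.Relation.Unary.Unique.Propositional using (Unique)
import Data.List.Relation.Unary.Unique.Propositional.Properties as Unique
open import Data.Maybe using (Maybe; just; nothing)
open import Data.Nat as ℕ using (zero; suc; _+_; z≤n; s≤s; ∣_-_∣; ⌊_/2⌋)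
import Data.Nat.Properties as ℕ
open import Data.Nat.Solver using (module +-*-Solver)
open import Data.Product using (∃-syntax; _,_; proj₁; proj₂)
open import Data.Product.Properties using (≡-dec)
open import Data.Sum using (_⊎_; inj₁; inj₂; [_,_]′)
open import Data.Unit as Unit using (tt)
import Data.Unit.Properties as Unit
open import Data.Vec using ([]; _∷_)
open import Data.Vec.Relation.Unary.All using ([]; _∷_; head; tail)
open import Data.Vec.Relation.Unary.All.Properties using (toList⁻)
open import Function using (_∘_; id; Inverse; Injection; Injective)
open import Function.Properties.Inverse using (↔⇒↣; ↔-sym)
open import Relation.Binary using (DecidableEquality)
open import Relation.Binary.Construct.Closure.ReflexiveTransitive
  using (Star; ε; _◅_; _◅◅_; gmap)
open import Relation.Binary.PropositionalEquality
  using (_≢_; refl; sym; trans; cong; cong₂; subst)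
open import Relation.Nullary using (¬_; Dec; yes; no; does; contradiction; recompute)
open import Relation.Nullary.Decidable
  using (_×-dec_; _⊎-dec_; ¬?; decidable-stable; map′)

open +-*-Solver using (solve; _:+_; _:*_; con; _:=_)

-- Edge colourings of bipartite multigraphs.

module Colouring {M : Set} (_≟_ : DecidableEquality M) where

  -- Elements of `M` are edges, and `f` gives the endpoint on one side. With `p` into `Fin n`,
  -- `Proper f p` also serves as the degree bound `n` on that side.
  Proper : {A C : Set} → (M → A) → (M → C) → List M → Set
  Proper f c xs = ∀ {x y} → x ∈ xs → y ∈ xs → f x ≡ f y → c x ≡ c y → x ≡ y

  -- The guard `x ≢ z` is there because `xs` may contain `x` itself.
  Free : {A C : Set} → (M → A) → (M → C) → List M → M → C → Set
  Free f c xs x a = ∀ {z} → z ∈ xs → x ≢ z → f x ≡ f z → c z ≢ a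

  _[_↦_] : {C : Set} → (M → C) → M → C → M → C
  (c [ x ↦ a ]) y = if does (x ≟ y) then a else c y

  proper-extend : ∀ {A C : Set} {f : M → A} {c : M → C} {xs x a} →
    Proper f c xs → Free f c xs x a → Proper f (c [ x ↦ a ]) (x ∷ xs)
  proper-extend {x = x} pr fr {u} {v} u∈ v∈ f≡ c≡ with x ≟ u | x ≟ v
  ... | yes refl | yes refl = refl
  ... | yes refl | no x≢v = contradiction (sym c≡) (fr (Any.tail (x≢v ∘ sym) v∈) x≢v f≡)
  ... | no x≢u | yes refl = contradiction c≡ (fr (Any.tail (x≢u ∘ sym) u∈) x≢u (sym f≡))
  ... | no x≢u | no x≢v = pr (Any.tail (x≢u ∘ sym) u∈) (Any.tail (x≢v ∘ sym) v∈) f≡ c≡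

  free-extend : ∀ {A C : Set} {f : M → A} {c : M → C} {xs x y a b} →
    Free f c xs x a → b ≢ a → Free f (c [ y ↦ b ]) (y ∷ xs) x a
  free-extend {y = y} fr b≢a {z} z∈ x≢z f≡ with y ≟ z
  ... | yes refl = b≢a
  ... | no y≢z = fr (Any.tail (y≢z ∘ sym) z∈) x≢z f≡

  bool-third : ∀ (a : Bool) {b c} → b ≢ a → c ≢ a → b ≡ c
  bool-third a b≢a c≢a = trans (¬-not b≢a) (sym (¬-not c≢a))

  -- `y` and `z` both avoid the colour of `x`, which leaves them one and the same Boolean.
  fibre≤2 : ∀ {A : Set} {f : M → A} {p : M → Bool} {xs x y z} → Proper f p xs →
    x ∈ xs → y ∈ xs → z ∈ xs → f x ≡ f y → f x ≡ f z → x ≢ y → x ≢ z → y ≡ z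
  fibre≤2 {p = p} {x = x} pr x∈ y∈ z∈ fxy fxz x≢y x≢z = pr y∈ z∈ (trans (sym fxy) fxz)
    (bool-third (p x) (λ e → x≢y (pr x∈ y∈ fxy (sym e))) (λ e → x≢z (pr x∈ z∈ fxz (sym e))))

  module _ {A B : Set} (_≟A_ : DecidableEquality A) (_≟B_ : DecidableEquality B)
           (f : M → A) (p : M → Bool) where

    -- Delete x together with its f-mate y and let the g-mates of x and y inherit a common
    -- g-key: the colouring of the rest gives these two different colours, so x and y can
    -- be coloured oppositely to each other and to their g-mates.
    two-colour-bounded : ∀ n xs → length xs ≤ n → (g : M → B) (q : M → Bool) →
      Proper f p xs → Proper g q xs → Σ[ c ∈ (M → Bool) ] (Proper f c xs × Proper g c xs)
    two-colour-bounded n [] _ g q _ _ = q , (λ ()) , λ ()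
    two-colour-bounded (suc n) (x ∷ xs) (s≤s len) g q pf pg
      with Any.any? (λ y → ¬? (x ≟ y) ×-dec (f x ≟A f y)) xs
    ... | no no-mate = c [ x ↦ b ] , grow {f = f} cf free-f , grow {f = g} cg (proj₂ free-g)
      where
      other? = λ z → ¬? (x ≟ z)
      ys = filter other? xs
      ys⊆ : ∀ {z} → z ∈ ys → z ∈ x ∷ xs
      ys⊆ = there ∘ proj₁ ∘ ∈-filter⁻ other?
      IH = two-colour-bounded n ys (ℕ.≤-trans (length-filter _ xs) len) g q
             (λ u v → pf (ys⊆ u) (ys⊆ v)) (λ u v → pg (ys⊆ u) (ys⊆ v))
      c = proj₁ IH
      cf = proj₁ (proj₂ IH)
      cg = proj₂ (proj₂ IH)
      -- By `fibre≤2`, `x` has at most one `g`-mate in `ys`, so negating the colour of any mate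
      -- found avoids them all.
      free-g : Σ[ b ∈ Bool ] Free g c ys x b
      free-g with Any.any? (λ z → g x ≟B g z) ys
      ... | no none = true , λ z∈ _ g≡ → contradiction (lose z∈ g≡) none
      ... | yes some with z₀ , z₀∈ , g₀ ← find some = not (c z₀) , λ z∈ x≢z g≡ c≡ →
        not-¬ (sym (cong c (fibre≤2 pg (here refl) (ys⊆ z₀∈) (ys⊆ z∈) g₀ g≡
                 (proj₂ (∈-filter⁻ other? {xs = xs} z₀∈)) x≢z))) c≡
      b = proj₁ free-g
      free-f : Free f c ys x b
      free-f z∈ x≢z f≡ = contradiction (lose (proj₁ (∈-filter⁻ other? z∈)) (x≢z , f≡)) no-mate
      ∈-x∷ys : ∀ {z} → z ∈ x ∷ xs → z ∈ x ∷ ys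
      ∈-x∷ys {z} z∈ with x ≟ z
      ... | yes refl = here refl
      ... | no x≢z = there (∈-filter⁺ other? (Any.tail (x≢z ∘ sym) z∈) x≢z)
      grow : ∀ {D : Set} {f : M → D} → Proper f c ys → Free f c ys x b →
        Proper f (c [ x ↦ b ]) (x ∷ xs)
      grow {f = f} pr fr u v = proper-extend {f = f} pr fr (∈-x∷ys u) (∈-x∷ys v)
    ... | yes mate with y , y∈ , x≢y , fx≡fy ← find mate =
        (c [ y ↦ not b ]) [ x ↦ b ]
        , grow {f = f} cf
            (λ z∈ x≢z f≡ → contradiction f≡ (f-fibre z∈))
            (λ z∈ y≢z f≡ → contradiction (trans fx≡fy f≡) (f-fibre z∈))
        , grow {f = g} cg (λ z∈ _ → proj₁ (proj₂ free-g) z∈) (λ z∈ _ → proj₂ (proj₂ free-g) z∈)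
      where
      other? = λ z → ¬? (x ≟ z) ×-dec ¬? (y ≟ z)
      ys = filter other? xs
      ys⊆ : ∀ {z} → z ∈ ys → z ∈ x ∷ xs
      ys⊆ = there ∘ proj₁ ∘ ∈-filter⁻ other?
      x≢ : ∀ {z} → z ∈ ys → x ≢ z
      x≢ z∈ = proj₁ (proj₂ (∈-filter⁻ other? {xs = xs} z∈))
      y≢ : ∀ {z} → z ∈ ys → y ≢ z
      y≢ z∈ = proj₂ (proj₂ (∈-filter⁻ other? {xs = xs} z∈))

      f-fibre : ∀ {z} → z ∈ ys → f x ≢ f z
      f-fibre z∈ f≡ = y≢ z∈ (fibre≤2 pf (here refl) (there y∈) (ys⊆ z∈) fx≡fy f≡ x≢y (x≢ z∈))

      g′ : M → B
      g′ z = if does (g y ≟B g z) then g x else g z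
      -- The merged class holds at most one former `g`-mate of `x` and one of `y`; `true` and
      -- `false` tell them apart, and all other classes keep `q`.
      q′ : M → Bool
      q′ z = if does (g x ≟B g z) then true else if does (g y ≟B g z) then false else q z

      unique-x : ∀ {u v} → u ∈ ys → v ∈ ys → g x ≡ g u → g x ≡ g v → u ≡ v
      unique-x u∈ v∈ gu gv = fibre≤2 pg (here refl) (ys⊆ u∈) (ys⊆ v∈) gu gv (x≢ u∈) (x≢ v∈)
      unique-y : ∀ {u v} → u ∈ ys → v ∈ ys → g y ≡ g u → g y ≡ g v → u ≡ v
      unique-y u∈ v∈ gu gv = fibre≤2 pg (there y∈) (ys⊆ u∈) (ys⊆ v∈) gu gv (y≢ u∈) (y≢ v∈)

      proper′ : Proper g′ q′ ys
      proper′ {u} {v} u∈ v∈ g≡ q≡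
        with g x ≟B g u | g x ≟B g v | g y ≟B g u | g y ≟B g v
      ... | yes gu | yes gv | _ | _ = unique-x u∈ v∈ gu gv
      ... | no _ | no _ | yes gu | yes gv = unique-y u∈ v∈ gu gv
      ... | no _ | no _ | no _ | no _ = pg (ys⊆ u∈) (ys⊆ v∈) g≡ q≡
      ... | yes _ | no _ | _ | yes _ = contradiction q≡ λ ()
      ... | yes _ | no ¬gv | yes _ | no _ = contradiction g≡ ¬gv
      ... | yes gu | no ¬gv | no _ | no _ = contradiction (trans gu g≡) ¬gv
      ... | no _ | yes _ | yes _ | _ = contradiction q≡ λ ()
      ... | no ¬gu | yes _ | no _ | yes _ = contradiction (sym g≡) ¬gu
      ... | no ¬gu | yes gv | no _ | no _ = contradiction (trans gv (sym g≡)) ¬gu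
      ... | no _ | no ¬gv | yes _ | no _ = contradiction g≡ ¬gv
      ... | no ¬gu | no _ | no _ | yes _ = contradiction (sym g≡) ¬gu

      IH = two-colour-bounded n ys (ℕ.≤-trans (length-filter _ xs) len) g′ q′
             (λ u v → pf (ys⊆ u) (ys⊆ v)) proper′
      c = proj₁ IH
      cf = proj₁ (proj₂ IH)

      merged-x : ∀ {z} → g x ≡ g z → g′ z ≡ g x
      merged-x {z} gz with g y ≟B g z
      ... | yes _ = refl
      ... | no _ = sym gz
      merged-y : ∀ {z} → g y ≡ g z → g′ z ≡ g x
      merged-y {z} gz with g y ≟B g z
      ... | yes _ = refl
      ... | no ¬gz = contradiction gz ¬gz

      -- `g′ z` depends on `z` only through `g z`, so properness for `g′` gives properness for `g`.
      cg : Proper g c ys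
      cg {u} {v} u∈ v∈ g≡ = proj₂ (proj₂ IH) u∈ v∈ (cong (λ k → if does (g y ≟B k) then g x else k) g≡)

      free-g : Σ[ b ∈ Bool ] ((∀ {z} → z ∈ ys → g x ≡ g z → c z ≢ b)
                            × (∀ {z} → z ∈ ys → g y ≡ g z → c z ≢ not b))
      free-g with Any.any? (λ z → g x ≟B g z) ys | Any.any? (λ z → g y ≟B g z) ys
      ... | no ¬gx | no ¬gy = true , (λ z∈ g≡ → contradiction (lose z∈ g≡) ¬gx)
                                   , (λ z∈ g≡ → contradiction (lose z∈ g≡) ¬gy)
      ... | no ¬gx | yes some with w , w∈ , gw ← find some = c w
        , (λ z∈ g≡ → contradiction (lose z∈ g≡) ¬gx)
        , (λ z∈ g≡ → not-¬ (cong c (unique-y z∈ w∈ g≡ gw)))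
      -- A `g`-mate of `y` differs from `w` but shares its merged key, so it has the colour opposite
      -- to `c w`; hence `y` can take `c w` and `x` the other colour.
      free-g | yes some | _ with w , w∈ , gw ← find some = not (c w)
        , (λ z∈ g≡ → not-¬ (cong c (unique-x z∈ w∈ g≡ gw)))
        , λ z∈ g≡ c≡ → x≢y-fibre z∈ g≡ w∈ gw
            (proj₂ (proj₂ IH) z∈ w∈ (trans (merged-y g≡) (sym (merged-x gw)))
              (trans c≡ (not-involutive _)))
        where
        x≢y-fibre : ∀ {z w} → z ∈ ys → g y ≡ g z → w ∈ ys → g x ≡ g w → z ≢ w
        x≢y-fibre z∈ gz w∈ gw refl =
          x≢y (sym (fibre≤2 pg (ys⊆ z∈) (there y∈) (here refl) (sym gz) (sym gw)
            (y≢ z∈ ∘ sym) (x≢ z∈ ∘ sym)))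
      b = proj₁ free-g

      ∈-x∷y∷ys : ∀ {z} → z ∈ x ∷ xs → z ∈ x ∷ y ∷ ys
      ∈-x∷y∷ys {z} z∈ with x ≟ z | y ≟ z
      ... | yes refl | _ = here refl
      ... | no _ | yes refl = there (here refl)
      ... | no x≢z | no y≢z = there (there (∈-filter⁺ other? (Any.tail (x≢z ∘ sym) z∈) (x≢z , y≢z)))
      grow : ∀ {D : Set} {f : M → D} → Proper f c ys → Free f c ys x b → Free f c ys y (not b) →
        Proper f ((c [ y ↦ not b ]) [ x ↦ b ]) (x ∷ xs)
      grow {f = f} pr frx fry u v = proper-extend {f = f} (proper-extend {f = f} pr fry)
        (free-extend {f = f} frx (not-¬ refl ∘ sym)) (∈-x∷y∷ys u) (∈-x∷y∷ys v)

    two-colour : ∀ xs (g : M → B) (q : M → Bool) → Proper f p xs → Proper g q xs →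
      Σ[ c ∈ (M → Bool) ] (Proper f c xs × Proper g c xs)
    two-colour xs = two-colour-bounded (length xs) xs ℕ.≤-refl

  -- The colours f-adjacent to x under c number fewer than n, because p colours the
  -- same fibre properly and also has to spare p x.
  free-colour : ∀ {A : Set} → DecidableEquality A → ∀ {n} {f : M → A} {p c : M → Fin n} {x xs} →
    Proper f p (x ∷ xs) → ∃[ a ] Free f c xs x a
  free-colour {A} _≟A_ {n} {f} {p} {c} {x} {xs} pf with Fin.any? (¬? ∘ used?)
    where
    Used : Fin n → Set
    Used a = Any (λ z → x ≢ z × f x ≡ f z × c z ≡ a) xs
    used? : ∀ a → Dec (Used a)
    used? a = Any.any? (λ z → ¬? (x ≟ z) ×-dec (f x ≟A f z) ×-dec (c z Fin.≟ a)) xs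
  ... | yes (a , unused) = a , λ z∈ x≢z f≡ c≡ → unused (lose z∈ (x≢z , f≡ , c≡))
  ... | no all-used = contradiction (Fin.injective⇒≤ κ-injective) ℕ.1+n≰n
    where
    user : ∀ a → Σ[ z ∈ M ] (z ∈ xs × x ≢ z × f x ≡ f z × c z ≡ a)
    user a = find (decidable-stable
      (Any.any? (λ z → ¬? (x ≟ z) ×-dec (f x ≟A f z) ×-dec (c z Fin.≟ a)) xs)
      (λ unused → all-used (a , unused)))
    κ : Fin (suc n) → Fin n
    κ zero = p x
    κ (suc a) = p (proj₁ (user a))
    κ-injective : ∀ {i j} → κ i ≡ κ j → i ≡ j
    κ-injective {zero} {zero} _ = refl
    κ-injective {zero} {suc b} κ≡ with z , z∈ , x≢z , f≡ , _ ← user b =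
      contradiction (pf (here refl) (there z∈) f≡ κ≡) x≢z
    κ-injective {suc a} {zero} κ≡ with z , z∈ , x≢z , f≡ , _ ← user a =
      contradiction (pf (here refl) (there z∈) f≡ (sym κ≡)) x≢z
    κ-injective {suc a} {suc b} κ≡
      with y , y∈ , _ , fy , cy ← user a | z , z∈ , _ , fz , cz ← user b =
      cong suc (trans (sym cy) (trans (cong c (pf (there y∈) (there z∈) (trans (sym fy) fz) κ≡)) cz))

  recolour : ∀ {P : M → Set} {C : Set} → (∀ z → Dec (P z)) → (M → C) → (M → C) → M → C
  recolour P? h c z = if does (P? z) then h z else c z

  -- Elements outside `P` never carry a colour in the image of `ι`, so the new colours inside `P`
  -- can clash only with one another.
  proper-recolour : ∀ {P : M → Set} (P? : ∀ z → Dec (P z)) {A C D : Set} {f : M → A} {c : M → C}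
    {h : M → D} (ι : D → C) {xs zs} → (∀ {s t} → ι s ≡ ι t → s ≡ t) →
    (∀ t {z} → c z ≡ ι t → P z) → (∀ {z} → ¬ P z → z ∈ zs → z ∈ xs) →
    Proper f c xs → Proper f h (filter P? zs) → Proper f (recolour P? (ι ∘ h) c) zs
  proper-recolour P? {h = h} ι inj ι⇒P ⊆xs pc ph {u} {v} u∈ v∈ f≡ r≡ with P? u | P? v
  ... | yes pu | yes pv = ph (∈-filter⁺ P? u∈ pu) (∈-filter⁺ P? v∈ pv) f≡ (inj r≡)
  ... | yes _ | no ¬pv = contradiction (ι⇒P (h u) (sym r≡)) ¬pv
  ... | no ¬pu | yes _ = contradiction (ι⇒P (h v) r≡) ¬pu
  ... | no ¬pu | no ¬pv = pc (⊆xs ¬pu u∈) (⊆xs ¬pv v∈) f≡ r≡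

  -- König's edge-colouring theorem for the bipartite multigraph whose edges x ∈ xs join
  -- f x to g x; the degree bound n is given by the one-sided colourings p and q.
  konig : ∀ {A B : Set} → DecidableEquality A → DecidableEquality B → ∀ {n} {f : M → A} {g : M → B}
    {p q : M → Fin n} xs → Proper f p xs → Proper g q xs →
    Σ[ c ∈ (M → Fin n) ] (Proper f c xs × Proper g c xs)
  konig _ _ {p = p} [] _ _ = p , (λ ()) , λ ()
  konig {A} {B} _≟A_ _≟B_ {n} {f} {g} (x ∷ xs) pf pg
    with c , cf , cg ← konig _≟A_ _≟B_ xs (λ u v → pf (there u) (there v))
                                          (λ u v → pg (there u) (there v))
    with a , free-a ← free-colour _≟A_ {c = c} pf | b , free-b ← free-colour _≟B_ {c = c} pg
    with a Fin.≟ b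
  ... | yes refl = c [ x ↦ a ] , proper-extend {f = f} cf free-a , proper-extend {f = g} cg free-b
  -- Instead of flipping an alternating path, all edges coloured `a` or `b`, together with `x`, are
  -- recoloured at once by `two-colour`.
  ... | no a≢b = recolour inPlay? (ab ∘ h) c
      , proper-recolour inPlay? ab ab-injective ab-inPlay (λ ¬p → Any.tail (¬p ∘ inj₁ ∘ sym))
          cf (proj₁ (proj₂ bicolouring))
      , proper-recolour inPlay? ab ab-injective ab-inPlay (λ ¬p → Any.tail (¬p ∘ inj₁ ∘ sym))
          cg (proj₂ (proj₂ bicolouring))
    where
    InPlay : M → Set
    InPlay z = x ≡ z ⊎ (c z ≡ a ⊎ c z ≡ b)
    inPlay? : ∀ z → Dec (InPlay z)
    inPlay? z = (x ≟ z) ⊎-dec ((c z Fin.≟ a) ⊎-dec (c z Fin.≟ b))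
    ys : List M
    ys = filter inPlay? (x ∷ xs)

    in-xs : ∀ {z} → z ∈ ys → x ≢ z → z ∈ xs
    in-xs z∈ x≢z = Any.tail (x≢z ∘ sym) (proj₁ (∈-filter⁻ inPlay? z∈))

    in-play : ∀ {z} → z ∈ ys → InPlay z
    in-play z∈ = proj₂ (∈-filter⁻ inPlay? {xs = x ∷ xs} z∈)

    is-a : M → Bool
    is-a z = does (c z Fin.≟ a)
    -- `x` counts as an `a`-edge on the `f` side, where `a` is free, and as a `b`-edge on the `g`
    -- side, where `b` is free. The two one-sided colourings differ only there.
    p′ q′ : M → Bool
    p′ = is-a [ x ↦ true ]
    q′ = is-a [ x ↦ false ]

    proper-is-a : ∀ {D : Set} (h : M → D) → Proper h c xs → ∀ {u v} → u ∈ ys → v ∈ ys →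
      x ≢ u → x ≢ v → h u ≡ h v → is-a u ≡ is-a v → u ≡ v
    proper-is-a h pr {u} {v} u∈ v∈ x≢u x≢v h≡ a≡
      = pr (in-xs u∈ x≢u) (in-xs v∈ x≢v) h≡ (same (in-play u∈) (in-play v∈) a≡)
      where
      same : InPlay u → InPlay v → is-a u ≡ is-a v → c u ≡ c v
      same (inj₁ e) _ _ = contradiction e x≢u
      same _ (inj₁ e) _ = contradiction e x≢v
      same (inj₂ s) (inj₂ t) e with c u Fin.≟ a | c v Fin.≟ a
      same _ _ _ | yes cu | yes cv = trans cu (sym cv)
      same (inj₂ (inj₁ cu)) _ _ | no ¬cu | no _ = contradiction cu ¬cu
      same _ (inj₂ (inj₁ cv)) _ | no _ | no ¬cv = contradiction cv ¬cv
      same (inj₂ (inj₂ cu)) (inj₂ (inj₂ cv)) _ | no _ | no _ = trans cu (sym cv)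

    proper-p′ : Proper f p′ ys
    proper-p′ {u} {v} u∈ v∈ f≡ p≡ with x ≟ u | x ≟ v
    ... | yes refl | yes refl = refl
    ... | no x≢u | no x≢v = proper-is-a f cf u∈ v∈ x≢u x≢v f≡ p≡
    ... | yes refl | no x≢v with c v Fin.≟ a
    ...   | yes cv = contradiction cv (free-a (in-xs v∈ x≢v) x≢v f≡)
    proper-p′ {u} {v} u∈ v∈ f≡ p≡ | no x≢u | yes refl with c u Fin.≟ a
    ...   | yes cu = contradiction cu (free-a (in-xs u∈ x≢u) x≢u (sym f≡))

    not-a : ∀ {z} → z ∈ ys → x ≢ z → c z ≢ a → c z ≡ b
    not-a z∈ x≢z ¬a with in-play z∈
    ... | inj₁ e = contradiction e x≢z
    ... | inj₂ (inj₁ e) = contradiction e ¬a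
    ... | inj₂ (inj₂ e) = e

    proper-q′ : Proper g q′ ys
    proper-q′ {u} {v} u∈ v∈ g≡ q≡ with x ≟ u | x ≟ v
    ... | yes refl | yes refl = refl
    ... | no x≢u | no x≢v = proper-is-a g cg u∈ v∈ x≢u x≢v g≡ q≡
    ... | yes refl | no x≢v with c v Fin.≟ a
    ...   | no ¬cv = contradiction (not-a v∈ x≢v ¬cv)
                       (free-b (in-xs v∈ x≢v) x≢v g≡)
    proper-q′ {u} {v} u∈ v∈ g≡ q≡ | no x≢u | yes refl with c u Fin.≟ a
    ...   | no ¬cu = contradiction (not-a u∈ x≢u ¬cu)
                       (free-b (in-xs u∈ x≢u) x≢u (sym g≡))

    bicolouring = two-colour _≟A_ _≟B_ f p′ ys g q′ proper-p′ proper-q′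
    h = proj₁ bicolouring

    ab : Bool → Fin n
    ab t = if t then a else b

    ab-injective : ∀ {s t} → ab s ≡ ab t → s ≡ t
    ab-injective {true}  {true}  _ = refl
    ab-injective {true}  {false} e = contradiction e a≢b
    ab-injective {false} {true}  e = contradiction (sym e) a≢b
    ab-injective {false} {false} _ = refl

    ab-inPlay : ∀ t {z} → c z ≡ ab t → InPlay z
    ab-inPlay true  e = inj₂ (inj₁ e)
    ab-inPlay false e = inj₂ (inj₂ e)

-- Walks, reversal and loop erasure.

module Walks (H : Graph) where
  open Graph H

  Joins : Node → Node → Node × Node → Set
  Joins u v s = s ≡ (u , v) ⊎ s ≡ (v , u)

  Uses : ∀ {x y} → Node → Node → Star _~_ x y → Set
  Uses u v w = Any (Joins u v) (steps w)

  uses-sym : ∀ {x y u v} {w : Star _~_ x y} → Uses u v w → Uses v u w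
  uses-sym = Any.map λ { (inj₁ e) → inj₂ e ; (inj₂ e) → inj₁ e }

  -- Bounds on length and on edge use both pass down along this relation. The endpoints may differ,
  -- so that reversals and suffixes compare with the original walk.
  record _⊑_ {x y x′ y′} (w : Star _~_ x y) (w′ : Star _~_ x′ y′) : Set where
    constructor mk⊑
    field
      shorter : length (steps w) ≤ length (steps w′)
      uses    : ∀ {u v} → Uses u v w → Uses u v w′
  open _⊑_ public

  ⊑-refl : ∀ {x y} {w : Star _~_ x y} → w ⊑ w
  ⊑-refl = mk⊑ ℕ.≤-refl id

  ⊑-trans : ∀ {x y x′ y′ x″ y″} {w : Star _~_ x y} {w′ : Star _~_ x′ y′} {w″ : Star _~_ x″ y″} →
    w ⊑ w′ → w′ ⊑ w″ → w ⊑ w″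
  ⊑-trans p q = mk⊑ (ℕ.≤-trans (shorter p) (shorter q)) (uses q ∘ uses p)

  ⊑-step : ∀ {x y z} {e : x ~ y} {w : Star _~_ y z} → w ⊑ (e ◅ w)
  ⊑-step = mk⊑ (ℕ.n≤1+n _) there

  ⊑-◅ : ∀ {x y z} {e : x ~ y} {w w′ : Star _~_ y z} → w ⊑ w′ → (e ◅ w) ⊑ (e ◅ w′)
  ⊑-◅ p = mk⊑ (s≤s (shorter p)) λ { (here j) → here j ; (there a) → there (uses p a) }

  steps-◅◅ : ∀ {x y z} (w : Star _~_ x y) (w′ : Star _~_ y z) →
    steps (w ◅◅ w′) ≡ steps w ++ steps w′
  steps-◅◅ ε w′ = refl
  steps-◅◅ (_ ◅ w) w′ = cong (_ ∷_) (steps-◅◅ w w′)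

  length-◅◅ : ∀ {x y z} (w : Star _~_ x y) (w′ : Star _~_ y z) →
    length (steps (w ◅◅ w′)) ≡ length (steps w) + length (steps w′)
  length-◅◅ w w′ = trans (cong length (steps-◅◅ w w′)) (length-++ (steps w))

  uses-◅◅ : ∀ {x y z u v} (w : Star _~_ x y) (w′ : Star _~_ y z) →
    Uses u v (w ◅◅ w′) → Uses u v w ⊎ Uses u v w′
  uses-◅◅ w w′ = Any.++⁻ (steps w) ∘ subst (Any _) (steps-◅◅ w w′)

  reverse : ∀ {x y} (w : Star _~_ x y) → Σ[ w′ ∈ Star _~_ y x ] w′ ⊑ w
  reverse ε = ε , ⊑-refl
  reverse {x} {y} (_◅_ {j = z} e w) with w′ , w′⊑w ← reverse w = w′ ◅◅ back , mk⊑
      (ℕ.≤-trans (ℕ.≤-reflexive (trans (length-◅◅ w′ back) (ℕ.+-comm _ 1))) (s≤s (shorter w′⊑w)))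
      ([ there ∘ uses w′⊑w , (λ { (here j) → here (flip j) }) ]′ ∘ uses-◅◅ w′ back)
    where
    back : Star _~_ z x
    back = ~-sym e ◅ ε
    flip : ∀ {u v} → Joins u v (z , x) → Joins u v (x , z)
    flip (inj₁ refl) = inj₂ refl
    flip (inj₂ refl) = inj₁ refl

  suffix : ∀ {x y z} (w : Star _~_ x y) → Unique (visited w) → z ∈ visited w →
    Σ[ p ∈ Path z y ] Path.walk p ⊑ w
  suffix ε u (here refl) = mkPath ε u , ⊑-refl
  suffix (e ◅ w) u (here refl) = mkPath (e ◅ w) u , ⊑-refl
  suffix (e ◅ w) (_ ∷ u) (there z∈) with p , p⊑w ← suffix w u z∈ = p , ⊑-trans p⊑w ⊑-step

  -- The rest of the walk is made simple first. If the resulting path meets `x` again, its suffix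
  -- from there suffices; otherwise the first step can be prepended.
  loopErase : ∀ {x y} (w : Star _~_ x y) → Σ[ p ∈ Path x y ] Path.walk p ⊑ w
  loopErase ε = mkPath ε (ListAll.[] ∷ []) , ⊑-refl
  loopErase {x} (e ◅ w) with mkPath w′ u , w′⊑w ← loopErase w with Any.any? (x ≟_) (visited w′)
  ... | yes x∈ = let p , p⊑w′ = suffix w′ u x∈
                 in p , ⊑-trans p⊑w′ (⊑-trans w′⊑w ⊑-step)
  ... | no x∉ = mkPath (e ◅ w′) (ListAll.¬Any⇒All¬ _ x∉ ∷ u) , ⊑-◅ w′⊑w

module _ (G H : Graph) (h : Graph.Node G → Graph.Node H)
  (hom : ∀ x y → Graph._~_ G x y → Graph._~_ H (h x) (h y)) where

  private
    module G = Graph G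
    module H = Graph H
    module WG = Walks G
    module WH = Walks H

  walk-map : ∀ {x y} → Star G._~_ x y → Star H._~_ (h x) (h y)
  walk-map = gmap h (λ {x y} → hom x y)

  length-map-walk : ∀ {x y} (w : Star G._~_ x y) →
    length (H.steps (walk-map w)) ≡ length (G.steps w)
  length-map-walk ε = refl
  length-map-walk (_ ◅ w) = cong suc (length-map-walk w)

  uses-map : ∀ {x y u v} (w : Star G._~_ x y) → WH.Uses u v (walk-map w) →
    Σ[ u′ ∈ G.Node ] Σ[ v′ ∈ G.Node ] (u ≡ h u′ × v ≡ h v′ × WG.Uses u′ v′ w)
  uses-map (_ ◅ w) (here (inj₁ refl)) = _ , _ , refl , refl , here (inj₁ refl)
  uses-map (_ ◅ w) (here (inj₂ refl)) = _ , _ , refl , refl , here (inj₂ refl)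
  uses-map (_ ◅ w) (there a) with u′ , v′ , u≡ , v≡ , a′ ← uses-map w a =
    u′ , v′ , u≡ , v≡ , there a′

-- Lines and rows of the grid.

coord-injective : ∀ {d} {ℓ : Vec ℕ d} {x y : GridNode ℓ} →
  (∀ i → coord x i ≡ coord y i) → x ≡ y
coord-injective {x = []} {[]} _ = refl
coord-injective {x = _ ∷ _} {_ ∷ _} eq =
  cong₂ _∷_ (Fin.toℕ-injective (eq zero)) (coord-injective (eq ∘ suc))

module _ {d} {ℓ : Vec ℕ d} where

  module _ {n : ℕ} where

    along : ∀ {a b : Fin n} (ρ : GridNode ℓ) → ∣ toℕ a - toℕ b ∣ ≡ 1 →
      GridAdjacent {ℓ = n ∷ ℓ} (a ∷ ρ) (b ∷ ρ)
    along ρ a~b = zero , a~b , λ { zero 0≢0 → contradiction refl 0≢0 ; (suc _) _ → refl }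

    across : ∀ (a : Fin n) {ρ σ : GridNode ℓ} → GridAdjacent ρ σ →
      GridAdjacent {ℓ = n ∷ ℓ} (a ∷ ρ) (a ∷ σ)
    across a (i , ρ~σ , rest) =
      suc i , ρ~σ , λ { zero _ → refl ; (suc j) j≢i → rest j (j≢i ∘ cong suc) }

    -- The differing coordinate is the first, giving an edge of a line, or a later one, giving an
    -- edge inside a row.
    adjacent-cases : ∀ {u v : GridNode (n ∷ ℓ)} → GridAdjacent u v →
      (tail u ≡ tail v × head u ≢ head v) ⊎ (head u ≡ head v × GridAdjacent (tail u) (tail v))
    adjacent-cases {a ∷ ρ} {b ∷ σ} (zero , a~b , rest) = inj₁
      ( coord-injective (λ i → rest (suc i) λ ())
      , λ { refl → contradiction (trans (sym (ℕ.∣n-n∣≡0 (toℕ a))) a~b) λ () } )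
    adjacent-cases {a ∷ ρ} {b ∷ σ} (suc i , ρ~σ , rest) = inj₂
      ( Fin.toℕ-injective (rest zero λ ())
      , i , ρ~σ , λ j j≢i → rest (suc j) (j≢i ∘ Fin.suc-injective) )

  -- A line of `n` nodes has only `n - 1` edges, whence the strict bound in `line`. The bound `m` is
  -- kept apart from `n` because `shift-line` enlarges the line but not the walk.
  Line : ∀ {n} → ℕ → GridNode ℓ → GridNode (n ∷ ℓ) → GridNode (n ∷ ℓ) → Set
  Line {n} m ρ x y = Σ[ w ∈ Star (GridAdjacent {ℓ = n ∷ ℓ}) x y ]
    (length (Graph.steps (grid (n ∷ ℓ)) w) < m ×
     (∀ {u v} → Walks.Uses (grid (n ∷ ℓ)) u v w → tail u ≡ ρ))

  shift : ∀ {n} → GridNode (n ∷ ℓ) → GridNode (suc n ∷ ℓ)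
  shift (a ∷ σ) = suc a ∷ σ

  shift-adjacent : ∀ {n} {u v : GridNode (n ∷ ℓ)} →
    GridAdjacent u v → GridAdjacent (shift u) (shift v)
  shift-adjacent {u = _ ∷ _} {_ ∷ _} (zero , a~b , rest) =
    zero , a~b , λ { zero 0≢0 → contradiction refl 0≢0 ; (suc j) j≢i → rest (suc j) j≢i }
  shift-adjacent {u = _ ∷ _} {_ ∷ _} (suc i , σ~τ , rest) =
    suc i , σ~τ , λ { zero _ → cong suc (rest zero λ ()) ; (suc j) j≢i → rest (suc j) j≢i }

  shift-line : ∀ {n m ρ} {a b : Fin n} → Line m ρ (a ∷ ρ) (b ∷ ρ) → Line m ρ (suc a ∷ ρ) (suc b ∷ ρ)
  shift-line {n} {m} {ρ} (w , len , on) = walk-map G H shift hom w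
    , subst (_< m) (sym (length-map-walk G H shift hom w)) len
    , onLine
    where
    G = grid (n ∷ ℓ)
    H = grid (suc n ∷ ℓ)
    hom = λ (u v : GridNode (n ∷ ℓ)) → shift-adjacent {u = u} {v}
    onLine : ∀ {u v} → Walks.Uses H u v (walk-map G H shift hom w) → tail u ≡ ρ
    onLine use with uses-map G H shift hom w use
    ... | (_ ∷ _) , _ , refl , _ , use′ = on use′

  line-up : ∀ {n} ρ (b : Fin (suc n)) → Line (suc n) ρ (zero ∷ ρ) (b ∷ ρ)
  line-up ρ zero = ε , s≤s z≤n , λ ()
  line-up {suc n} ρ (suc b) with w , len , on ← shift-line (line-up {n} ρ b) =
    along {a = zero} {suc zero} ρ refl ◅ w , s≤s len
      , λ { (here (inj₁ refl)) → refl ; (here (inj₂ refl)) → refl ; (there use) → on use }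

  -- Both ends move down together until one is `zero`; what remains is an upward walk or the reverse
  -- of one.
  line : ∀ {n} ρ (a b : Fin n) → Line n ρ (a ∷ ρ) (b ∷ ρ)
  line ρ zero b = line-up ρ b
  line {suc n} ρ (suc a) zero with w , len , on ← line-up ρ (suc a)
    with w′ , w′⊑w ← Walks.reverse (grid (suc n ∷ ℓ)) w =
      w′ , ℕ.≤-<-trans (Walks.shorter w′⊑w) len
         , on ∘ Walks.uses w′⊑w
  line ρ (suc a) (suc b) with w , len , on ← shift-line (line ρ a b) = w , ℕ.m≤n⇒m≤1+n len , on

  -- `All` is a data type without eta, so `x` must be split before it is a cons of its head and
  -- tail.
  line-from : ∀ {n} (x : GridNode (n ∷ ℓ)) (b : Fin n) → Line n (tail x) x (b ∷ tail x)
  line-from (a ∷ ρ) b = line ρ a b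

  line-to : ∀ {n} (a : Fin n) (y : GridNode (n ∷ ℓ)) → Line n (tail y) (a ∷ tail y) y
  line-to a (b ∷ ρ) = line ρ a b

-- Counting by injective numberings.

-- A numbering that is injective where `P` holds restricts to subsets and combines over unions
-- without lists; `length-filter-atMost` turns it into a count at the end.
AtMost : ∀ {M : Set} → ℕ → (M → Set) → Set
AtMost {M} n P = Σ[ κ ∈ (M → Fin n) ] (∀ {x y} → P x → P y → κ x ≡ κ y → x ≡ y)

module _ {M : Set} where

  atMost-mono : ∀ {m n} {P Q : M → Set} → m ≤ n → (∀ {x} → Q x → P x) → AtMost m P → AtMost n Q
  atMost-mono m≤n Q⇒P (κ , inj) = (λ x → Fin.inject≤ (κ x) m≤n)
    , λ qx qy κ≡ → inj (Q⇒P qx) (Q⇒P qy) (Fin.inject≤-injective _ _ _ _ κ≡)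

  -- The two numberings are placed in consecutive blocks. An element of both sets takes its `P`
  -- number, so deciding `P` is enough.
  atMost-∪ : ∀ {m n} {P Q R : M → Set} → (∀ x → Dec (P x)) → (∀ {x} → R x → P x ⊎ Q x) →
    AtMost m P → AtMost n Q → AtMost (m + n) R
  atMost-∪ {m} {n} {P} {Q} {R} P? R⇒ (κ , κ-inj) (ν , ν-inj) = μ , μ-inj
    where
    μ : M → Fin (m + n)
    μ x with P? x
    ... | yes _ = κ x Fin.↑ˡ n
    ... | no _ = m Fin.↑ʳ ν x
    other : ∀ {x} → R x → ¬ P x → Q x
    other r ¬p = [ (λ p → contradiction p ¬p) , id ]′ (R⇒ r)
    μ-inj : ∀ {x y} → R x → R y → μ x ≡ μ y → x ≡ y
    μ-inj {x} {y} rx ry eq with P? x | P? y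
    ... | yes px | yes py = κ-inj px py (Fin.↑ˡ-injective n _ _ eq)
    ... | no ¬px | no ¬py = ν-inj (other rx ¬px) (other ry ¬py) (Fin.↑ʳ-injective m _ _ eq)
    ... | yes _ | no _ = contradiction
      (trans (sym (Fin.splitAt-↑ˡ m (κ x) n))
        (trans (cong (Fin.splitAt m) eq) (Fin.splitAt-↑ʳ m n (ν y)))) λ ()
    ... | no _ | yes _ = contradiction
      (trans (sym (Fin.splitAt-↑ˡ m (κ y) n))
        (trans (cong (Fin.splitAt m) (sym eq)) (Fin.splitAt-↑ʳ m n (ν x)))) λ ()

  lookup-injective : ∀ {xs : List M} → Unique xs → ∀ {i j} →
    List.lookup xs i ≡ List.lookup xs j → i ≡ j
  lookup-injective (_ ∷ u) {zero} {zero} _ = refl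
  lookup-injective (x∉ ∷ _) {zero} {suc j} eq = contradiction eq (ListAll.lookup x∉ (∈-lookup j))
  lookup-injective (x∉ ∷ _) {suc i} {zero} eq = contradiction (sym eq) (ListAll.lookup x∉ (∈-lookup i))
  lookup-injective (_ ∷ u) {suc i} {suc j} eq = cong suc (lookup-injective u eq)

  length-filter-atMost : ∀ {n} {P : M → Set} (P? : ∀ x → Dec (P x)) {xs} → Unique xs →
    AtMost n P → length (filter P? xs) ≤ n
  length-filter-atMost P? {xs} u (κ , inj) = Fin.injective⇒≤ λ {i} {j} eq →
    lookup-injective (Unique.filter⁺ P? u) (inj (P-lookup i) (P-lookup j) eq)
    where
    P-lookup = λ i → proj₂ (∈-filter⁻ P? {xs = xs} (∈-lookup i))

  -- For `J = Fin k` this bounds by `k` the messages of one class `r` at one position `s`, in the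
  -- form that the recursion passes on.
  Separates : ∀ {X Y J : Set} → (M → X) → (M → Y) → (M → J) → Set
  Separates r s j = ∀ {x y} → r x ≡ r y → s x ≡ s y → j x ≡ j y → x ≡ y

-- Routing by recursion on the dimension.

module Routing {M : Set} (_≟_ : DecidableEquality M) (xs : List M) (complete : ∀ x → x ∈ xs)
               (k b : ℕ) where
  open Colouring _≟_

  -- r x records the coordinates of message x fixed at earlier levels of the recursion;
  -- js x and jt x tell apart the at most k messages with a common source, resp. target.
  route : ∀ {d} {ℓ : Vec ℕ d} → All (_≤ b) ℓ → ∀ {X : Set} → DecidableEquality X →
    (r : M → X) (s t : M → GridNode ℓ) (js jt : M → Fin k) →
    Separates r s js → Separates r t jt →
    Σ[ w ∈ (∀ x → Star (GridAdjacent {ℓ = ℓ}) (s x) (t x)) ]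
      ((∀ x → length (Graph.steps (grid ℓ) (w x)) ≤ 2 * sum (toList ℓ)) ×
       (∀ ξ {u v} → GridAdjacent u v →
         AtMost (2 * k * b) (λ x → r x ≡ ξ × Walks.Uses (grid ℓ) u v (w x))))
  route {ℓ = []} [] _ r s t _ _ _ _ = (λ x → trivial (s x) (t x)) , (λ x → short (s x) (t x)) , λ _ ()
    where
    trivial : ∀ (u v : GridNode []) → Star (GridAdjacent {ℓ = []}) u v
    trivial [] [] = ε
    short : ∀ u v → length (Graph.steps (grid []) (trivial u v)) ≤ 0
    short [] [] = z≤n
  route {ℓ = n ∷ ℓ} (n≤b ∷ ℓ≤b) {X} _≟X_ r s t js jt sep-s sep-t = walk , short , congestion
    where
    G = grid (n ∷ ℓ)
    T = grid ℓ
    module G = Graph G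
    module T = Graph T
    module WG = Walks G
    module WT = Walks T

    _≟K_ : DecidableEquality (X × T.Node × Fin k)
    _≟K_ = ≡-dec _≟X_ (≡-dec T._≟_ Fin._≟_)

    -- A vertex of the multigraph: copy `j x` of the residual position, separately for each class of
    -- `r`.
    key : (M → G.Node) → (M → Fin k) → M → X × T.Node × Fin k
    key p j x = r x , tail (p x) , j x

    head-tail-≡ : ∀ {u v : G.Node} → head u ≡ head v → tail u ≡ tail v → u ≡ v
    head-tail-≡ {_ ∷ _} {_ ∷ _} = cong₂ _∷_

    -- Messages at the same vertex differ in their first coordinate, so `head ∘ p` is the colouring
    -- by `Fin n` that `konig` takes as its degree bound.
    proper-key : ∀ {p j} → Separates r p j → Proper (key p j) (head ∘ p) xs
    proper-key sep _ _ key≡ head≡ = sep (cong proj₁ key≡)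
      (head-tail-≡ head≡ (cong (proj₁ ∘ proj₂) key≡)) (cong (proj₂ ∘ proj₂) key≡)

    colouring = konig _≟K_ _≟K_ xs (proper-key sep-s) (proper-key sep-t)
    row : M → Fin n
    row = proj₁ colouring

    -- Read differently, a proper row colouring says that `j` still separates the messages that
    -- share class, row and residual position.
    sep-tail : ∀ p {j} → Proper (key p j) row xs → Separates (λ x → r x , row x) (tail ∘ p) j
    sep-tail _ pr r≡ t≡ j≡ = pr (complete _) (complete _)
      (cong₂ _,_ (cong proj₁ r≡) (cong₂ _,_ t≡ j≡)) (cong proj₂ r≡)

    -- With the row added to the class, one recursive call routes all rows simultaneously.
    inner = route ℓ≤b (≡-dec _≟X_ Fin._≟_) (λ x → r x , row x) (tail ∘ s) (tail ∘ t) js jt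
              (sep-tail s (proj₁ (proj₂ colouring))) (sep-tail t (proj₂ (proj₂ colouring)))

    first : ∀ x → Line n (tail (s x)) (s x) (row x ∷ tail (s x))
    first x = line-from (s x) (row x)
    middle : ∀ x → Star G._~_ (row x ∷ tail (s x)) (row x ∷ tail (t x))
    middle x = walk-map T G (row x ∷_) (λ _ _ → across (row x)) (proj₁ inner x)
    last : ∀ x → Line n (tail (t x)) (row x ∷ tail (t x)) (t x)
    last x = line-to (row x) (t x)

    walk : ∀ x → Star G._~_ (s x) (t x)
    walk x = proj₁ (first x) ◅◅ (middle x ◅◅ proj₁ (last x))

    short : ∀ x → length (G.steps (walk x)) ≤ 2 * (n + sum (toList ℓ))
    short x = begin
      length (G.steps (walk x))
        ≡⟨ WG.length-◅◅ (proj₁ (first x)) _ ⟩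
      length (G.steps (proj₁ (first x))) + length (G.steps (middle x ◅◅ proj₁ (last x)))
        ≡⟨ cong (length (G.steps (proj₁ (first x))) +_) (WG.length-◅◅ (middle x) _) ⟩
      length (G.steps (proj₁ (first x))) +
        (length (G.steps (middle x)) + length (G.steps (proj₁ (last x))))
        ≤⟨ ℕ.+-mono-≤ (ℕ.<⇒≤ (proj₁ (proj₂ (first x))))
             (ℕ.+-mono-≤ (ℕ.≤-reflexive (length-map-walk T G (row x ∷_) (λ _ _ → across (row x)) (proj₁ inner x)))
                         (ℕ.<⇒≤ (proj₁ (proj₂ (last x))))) ⟩
      n + (length (T.steps (proj₁ inner x)) + n)
        ≤⟨ ℕ.+-monoʳ-≤ n (ℕ.+-monoˡ-≤ n (proj₁ (proj₂ inner) x)) ⟩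
      n + (2 * sum (toList ℓ) + n)
        ≡⟨ solve 2 (λ n S → n :+ (con 2 :* S :+ n) := con 2 :* (n :+ S)) refl n (sum (toList ℓ)) ⟩
      2 * (n + sum (toList ℓ)) ∎
      where open ℕ.≤-Reasoning

    -- Such a message is determined by its position on the line, with `n` choices, and its copy,
    -- with `k` choices.
    line-load : ∀ (p : M → G.Node) (j : M → Fin k) → Separates r p j → ∀ ξ ρ →
      AtMost (n * k) (λ x → r x ≡ ξ × tail (p x) ≡ ρ)
    line-load p j sep ξ ρ = (λ x → Fin.combine (head (p x)) (j x))
      , λ { (rx , px) (ry , py) eq → let head≡ , j≡ = Fin.combine-injective _ _ _ _ eq in
            sep (trans rx (sym ry)) (head-tail-≡ head≡ (trans px (sym py))) j≡ }

    on-line : ∀ {m ρ x y u v} (l : Line m ρ x y) → WG.Uses u v (proj₁ l) →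
      ρ ≡ tail u × tail u ≡ tail v
    on-line (w , _ , on) use = sym (on use) , trans (on use) (sym (on (WG.uses-sym {w = w} use)))

    uses-walk : ∀ {x u v} → WG.Uses u v (walk x) →
      (tail (s x) ≡ tail u × tail u ≡ tail v) ⊎ (tail (t x) ≡ tail u × tail u ≡ tail v) ⊎
      WG.Uses u v (middle x)
    uses-walk {x} use with WG.uses-◅◅ (proj₁ (first x)) _ use
    ... | inj₁ use₁ = inj₁ (on-line (first x) use₁)
    ... | inj₂ use′ with WG.uses-◅◅ (middle x) _ use′
    ...   | inj₁ use₂ = inj₂ (inj₂ use₂)
    ...   | inj₂ use₃ = inj₂ (inj₁ (on-line (last x) use₃))

    uses-middle : ∀ {x u v} → WG.Uses u v (middle x) →
      row x ≡ head u × row x ≡ head v × WT.Uses (tail u) (tail v) (proj₁ inner x)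
    uses-middle {x} use with uses-map T G (row x ∷_) (λ _ _ → across (row x)) (proj₁ inner x) use
    ... | _ , _ , refl , refl , use′ = refl , refl , use′

    congestion : ∀ ξ {u v} → u G.~ v → AtMost (2 * k * b) (λ x → r x ≡ ξ × WG.Uses u v (walk x))
    congestion ξ {u} {v} u~v with adjacent-cases {u = u} {v} u~v
    -- The middle phase keeps the first coordinate and never uses a line edge; the first and the
    -- last phase bring at most `n * k` messages each.
    ... | inj₁ (_ , head≢) = atMost-mono bound id
      (atMost-∪ (λ x → (r x ≟X ξ) ×-dec (tail (s x) T.≟ tail u)) split
        (line-load s js sep-s ξ (tail u)) (line-load t jt sep-t ξ (tail u)))
      where
      bound : n * k + n * k ≤ 2 * k * b
      bound = ℕ.≤-trans (ℕ.≤-reflexive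
        (solve 2 (λ n k → n :* k :+ n :* k := con 2 :* k :* n) refl n k)) (ℕ.*-monoʳ-≤ (2 * k) n≤b)
      split : ∀ {x} → r x ≡ ξ × WG.Uses u v (walk x) →
        (r x ≡ ξ × tail (s x) ≡ tail u) ⊎ (r x ≡ ξ × tail (t x) ≡ tail u)
      split {x} (rx , use) with uses-walk {x} use
      ... | inj₁ (on , _) = inj₁ (rx , on)
      ... | inj₂ (inj₁ (on , _)) = inj₂ (rx , on)
      ... | inj₂ (inj₂ use₂) with row-u , row-v , _ ← uses-middle {x} use₂ =
        contradiction (trans (sym row-u) row-v) head≢
    -- The outer phases keep the residual position and never use a row edge; its load is that of the
    -- inner routing in the class extended by its row.
    ... | inj₂ (head≡ , tail~) = atMost-mono ℕ.≤-refl recurse (proj₂ (proj₂ inner) (ξ , head u) tail~)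
      where
      tail≢ : tail u ≢ tail v
      tail≢ e = T.~-irrefl {tail u} (subst (GridAdjacent (tail u)) (sym e) tail~)
      recurse : ∀ {x} → r x ≡ ξ × WG.Uses u v (walk x) →
        (r x , row x) ≡ (ξ , head u) × WT.Uses (tail u) (tail v) (proj₁ inner x)
      recurse {x} (rx , use) with uses-walk {x} use
      ... | inj₁ (_ , tail≡) = contradiction tail≡ tail≢
      ... | inj₂ (inj₁ (_ , tail≡)) = contradiction tail≡ tail≢
      ... | inj₂ (inj₂ use₂) with row-u , _ , use′ ← uses-middle {x} use₂ = cong₂ _,_ rx row-u , use′

-- Membership and uniqueness for `mapMaybe`.

module _ {A B : Set} {f : A → Maybe B} where

  ∈-mapMaybe : ∀ {xs x y} → x ∈ xs → f x ≡ just y → y ∈ mapMaybe f xs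
  ∈-mapMaybe {x ∷ xs} (here refl) eq with just _ ← f x | refl ← eq = here refl
  ∈-mapMaybe {x ∷ xs} (there x∈) eq with f x
  ... | just _ = there (∈-mapMaybe x∈ eq)
  ... | nothing = ∈-mapMaybe x∈ eq

  mapMaybe-unique : (∀ {x y z} → f x ≡ just z → f y ≡ just z → x ≡ y) →
    ∀ {xs} → Unique xs → Unique (mapMaybe f xs)
  mapMaybe-unique inj [] = []
  mapMaybe-unique inj {x ∷ xs} (x∉ ∷ u) with f x in fx
  ... | nothing = mapMaybe-unique inj u
  ... | just z = fresh x∉ ∷ mapMaybe-unique inj u
    where
    fresh : ∀ {ys} → ListAll.All (x ≢_) ys → ListAll.All (z ≢_) (mapMaybe f ys)
    fresh ListAll.[] = ListAll.[]
    fresh {y ∷ ys} (x≢y ListAll.∷ a) with f y in fy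
    ... | nothing = fresh a
    ... | just _ = (λ { refl → x≢y (inj fx fy) }) ListAll.∷ fresh a

-- Pairing numbers by halving.

odd : ℕ → Bool
odd zero = false
odd (suc n) = not (odd n)

⌊/2⌋-odd-injective : ∀ {m n} → ⌊ m /2⌋ ≡ ⌊ n /2⌋ → odd m ≡ odd n → m ≡ n
⌊/2⌋-odd-injective {zero} {zero} _ _ = refl
⌊/2⌋-odd-injective {suc zero} {suc zero} _ _ = refl
⌊/2⌋-odd-injective {zero} {suc zero} _ ()
⌊/2⌋-odd-injective {zero} {suc (suc _)} ()
⌊/2⌋-odd-injective {suc zero} {zero} _ ()
⌊/2⌋-odd-injective {suc zero} {suc (suc _)} ()
⌊/2⌋-odd-injective {suc (suc _)} {zero} ()
⌊/2⌋-odd-injective {suc (suc _)} {suc zero} ()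
⌊/2⌋-odd-injective {suc (suc m)} {suc (suc n)} h o = cong (2 ℕ.+_)
  (⌊/2⌋-odd-injective (ℕ.suc-injective h) (Bool.not-injective (Bool.not-injective o)))

-- `⌈ n /2⌉` unfolds to `⌊ suc n /2⌋`, and `suc ⌊ i /2⌋` is `⌊ suc (suc i) /2⌋`, so monotonicity
-- suffices.
⌊/2⌋<⌈/2⌉ : ∀ {i n} → i < n → ⌊ i /2⌋ < ⌈ n /2⌉
⌊/2⌋<⌈/2⌉ i<n = ℕ.⌊n/2⌋-mono (s≤s i<n)

-- Edges, half-edges and the balanced orientation.

module _ (G : Graph) where
  open Graph G

  ∈-nodes : ∀ v → v ∈ nodes
  ∈-nodes v = subst (_∈ nodes) (Inverse.strictlyInverseʳ indexing v) (∈-map⁺ _ (∈-allFin (index v)))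

  unique-nodes : Unique nodes
  unique-nodes = Unique.map⁺ (Injection.injective (↔⇒↣ (↔-sym indexing))) (Unique.allFin⁺ order)

  edge?-complete : ∀ e → edge? (source e , target e) ≡ just e
  edge?-complete (mkEdge u v u<v u~v) with index u Fin.<? index v | u ~? v
  ... | yes _ | yes _ = refl
  ... | no u≮v | _ = ⊥-elim-irr (u≮v u<v)
  ... | yes _ | no u≁v = ⊥-elim-irr (u≁v u~v)

  edge?-ends : ∀ {uv e} → edge? uv ≡ just e → uv ≡ (source e , target e)
  edge?-ends {u , v} eq with index u Fin.<? index v | u ~? v
  edge?-ends refl | yes _ | yes _ = refl
  edge?-ends () | yes _ | no _
  edge?-ends () | no _ | _

  ∈-edges : ∀ e → e ∈ edges
  ∈-edges e = ∈-mapMaybe (∈-cartesianProduct⁺ (∈-nodes (source e)) (∈-nodes (target e)))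
                         (edge?-complete e)

  unique-edges : Unique edges
  unique-edges = mapMaybe-unique (λ p q → trans (edge?-ends p) (sym (edge?-ends q)))
                   (Unique.cartesianProduct⁺ unique-nodes unique-nodes)

  edge-≡ : ∀ {e e′} → source e ≡ source e′ → target e ≡ target e′ → e ≡ e′
  edge-≡ {mkEdge _ _ _ _} {mkEdge _ _ _ _} refl refl = refl

  _≟E_ : DecidableEquality Edge
  e ≟E e′ = map′ (λ (p , q) → edge-≡ p q) (λ { refl → refl , refl })
                 (source e ≟ source e′ ×-dec target e ≟ target e′)

  degree≤maxDegree : ∀ v → degree v ≤ maxDegree
  degree≤maxDegree v = ListAll.lookup (xs≤max 0 (map degree nodes)) (∈-map⁺ degree (∈-nodes v))

  HalfEdge : Set
  HalfEdge = Edge × Bool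

  end : HalfEdge → Node
  end (e , true)  = source e
  end (e , false) = target e

  far : HalfEdge → Node
  far (e , b) = end (e , not b)

  end~far : ∀ h → end h ~ far h
  -- Adjacency is stored irrelevantly in an edge; its decidability recovers a usable proof.
  end~far (mkEdge u v _ u~v , true) = recompute (u ~? v) u~v
  end~far (mkEdge u v _ u~v , false) = ~-sym (recompute (u ~? v) u~v)

  -- An edge is stored with its smaller index first, which rules out two opposite copies of one
  -- edge.
  halfEdge-≡ : ∀ {h h′} → end h ≡ end h′ → far h ≡ far h′ → h ≡ h′
  halfEdge-≡ {_ , true} {_ , true} p q = cong (_, true) (edge-≡ p q)
  halfEdge-≡ {_ , false} {_ , false} p q = cong (_, false) (edge-≡ q p)
  halfEdge-≡ {mkEdge _ _ u<v _ , true} {mkEdge _ _ v<u _ , false} refl refl =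
    ⊥-elim-irr (ℕ.<-asym u<v v<u)
  halfEdge-≡ {mkEdge _ _ u<v _ , false} {mkEdge _ _ v<u _ , true} refl refl =
    ⊥-elim-irr (ℕ.<-asym u<v v<u)

  far∈ : ∀ h → far h ∈ filter (end h ~?_) nodes
  far∈ h = ∈-filter⁺ (end h ~?_) (∈-nodes (far h)) (end~far h)

  port : HalfEdge → ℕ
  port h = toℕ (Any.index (far∈ h))

  port-injective : ∀ {h h′} → end h ≡ end h′ → port h ≡ port h′ → h ≡ h′
  port-injective {h} {h′} end≡ port≡ = halfEdge-≡ end≡ (same-entry end≡ (far∈ h) (far∈ h′) port≡)
    where
    -- The ends are generalised to variables so that their equality can be matched and the two
    -- neighbour lists coincide.
    same-entry : ∀ {u v x y} → u ≡ v →
      (p : x ∈ filter (u ~?_) nodes) (q : y ∈ filter (v ~?_) nodes) →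
      toℕ (Any.index p) ≡ toℕ (Any.index q) → x ≡ y
    same-entry {u} refl p q eq = trans (Any.lookup-index p)
      (trans (cong (List.lookup (filter (u ~?_) nodes)) (Fin.toℕ-injective eq))
        (sym (Any.lookup-index q)))

  slot : HalfEdge → Fin ⌈ maxDegree /2⌉
  slot h = Fin.fromℕ< (⌊/2⌋<⌈/2⌉
    (ℕ.<-≤-trans (Fin.toℕ<n (Any.index (far∈ h))) (degree≤maxDegree (end h))))

  _≟H_ : DecidableEquality HalfEdge
  _≟H_ = ≡-dec _≟E_ Bool._≟_

  halfEdges : List HalfEdge
  halfEdges = cartesianProduct edges (true ∷ false ∷ [])

  ∈-halfEdges : ∀ h → h ∈ halfEdges
  ∈-halfEdges (e , true)  = ∈-cartesianProduct⁺ (∈-edges e) (here refl)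
  ∈-halfEdges (e , false) = ∈-cartesianProduct⁺ (∈-edges e) (there (here refl))

  -- Pairing the ports 2j and 2j+1 at every node and the two halves of every edge, a proper
  -- 2-colouring of the half-edges reads as an orientation in which each pair of ports
  -- has at most one outgoing and at most one incoming half.
  balanced-orientation : Σ[ o ∈ (Edge → Bool) ]
    (Separates (λ _ → tt) (λ e → end (e , o e)) (λ e → slot (e , o e)) ×
     Separates (λ _ → tt) (λ e → far (e , o e)) (λ e → slot (e , not (o e))))
  balanced-orientation with c , cf , cg ← Colouring.two-colour _≟H_ (≡-dec _≟_ Fin._≟_) _≟E_
        (λ h → end h , slot h) (odd ∘ port) halfEdges proj₁ proj₂
        (λ _ _ key≡ odd≡ → port-injective (cong proj₁ key≡)
          (⌊/2⌋-odd-injective (Fin.fromℕ<-injective _ _ _ _ (cong proj₂ key≡)) odd≡))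
        (λ _ _ → cong₂ _,_)
    -- With this choice `(e , o e)` is always the half coloured `true`, the outgoing one, and
    -- `(e , not (o e))` is the half coloured `false`.
    = (λ e → c (e , true)) , sep (λ e → c (e , true)) true out
      , sep (λ e → not (c (e , true))) false inn
    where
    differ : ∀ e → c (e , true) ≢ c (e , false)
    differ e eq with () ← cg (∈-halfEdges (e , true)) (∈-halfEdges (e , false)) refl eq
    out : ∀ e → c (e , c (e , true)) ≡ true
    out e with c (e , true) in eq
    ... | true = eq
    ... | false = ¬-not (λ eq′ → differ e (trans eq (sym eq′)))
    inn : ∀ e → c (e , not (c (e , true))) ≡ false
    inn e with c (e , true) in eq
    ... | true = ¬-not (λ eq′ → differ e (trans eq (sym eq′)))
    ... | false = eq
    sep : (o : Edge → Bool) (b : Bool) → (∀ e → c (e , o e) ≡ b) →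
      Separates (λ _ → tt) (λ e → end (e , o e)) (λ e → slot (e , o e))
    sep o b colour _ end≡ slot≡ = cong proj₁ (cf (∈-halfEdges _) (∈-halfEdges _)
      (cong₂ _,_ end≡ slot≡) (trans (colour _) (sym (colour _))))

-- Assembling the embedding.

embed : (G : Graph) {d : ℕ} (ℓ : Vec ℕ d) → Graph.order G ≤ product (toList ℓ) →
  Σ[ E ∈ Embedding G (grid ℓ) ]
    (Embedding.dilation E ≤ 2 * sum (toList ℓ) ×
     Embedding.edgeCongestion E ≤ 2 * ⌈ Graph.maxDegree G /2⌉ * max 0 (toList ℓ))
embed G {d} ℓ fits = E
  -- `z≤n` accounts for the default value `0` of the maximum.
  , max≤v⁺ z≤n (ListAll.map⁺ (ListAll.universal dilated G.edges))
  , max≤v⁺ z≤n (ListAll.map⁺ (ListAll.universal congested H.edges))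
  where
  H = grid ℓ
  module G = Graph G
  module H = Graph H
  module W = Walks H

  φ : G.Node → H.Node
  φ v = Inverse.from (gridIndexing ℓ) (Fin.inject≤ (G.index v) fits)

  φ-injective : Injective _≡_ _≡_ φ
  φ-injective eq = Injection.injective (↔⇒↣ G.indexing)
    (Fin.inject≤-injective fits fits _ _ (Injection.injective (↔⇒↣ (↔-sym (gridIndexing ℓ))) eq))

  orientation = balanced-orientation G
  o = proj₁ orientation

  -- At the outset no coordinate is fixed, so all messages share the class `tt`; injectivity of `φ`
  -- carries the bound per node over to grid positions.
  routed = Routing.route (_≟E_ G) G.edges (∈-edges G) ⌈ G.maxDegree /2⌉ (max 0 (toList ℓ))
    (toList⁻ (xs≤max 0 (toList ℓ))) Unit._≟_ (λ _ → tt)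
    (λ e → φ (end G (e , o e))) (λ e → φ (far G (e , o e)))
    (λ e → slot G (e , o e)) (λ e → slot G (e , not (o e)))
    (λ _ φ≡ → proj₁ (proj₂ orientation) refl (φ-injective φ≡))
    (λ _ φ≡ → proj₂ (proj₂ orientation) refl (φ-injective φ≡))
  w = proj₁ routed

  -- Messages travel along the orientation, while `ρ` must run from source to target.
  unorient : ∀ e b (w : Star H._~_ (φ (end G (e , b))) (φ (far G (e , b)))) →
    Σ[ w′ ∈ Star H._~_ (φ (G.source e)) (φ (G.target e)) ] w′ W.⊑ w
  unorient e true w = w , W.⊑-refl
  unorient e false w = W.reverse w

  path : ∀ e → Σ[ p ∈ H.Path (φ (G.source e)) (φ (G.target e)) ] H.Path.walk p W.⊑ w e
  path e = let w′ , w′⊑w = unorient e (o e) (w e)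
               p , p⊑w′ = W.loopErase w′
           in p , W.⊑-trans p⊑w′ w′⊑w

  E : Embedding G H
  E = record { φ = φ ; φ-injective = φ-injective ; ρ = proj₁ ∘ path }

  dilated : ∀ e → H.pathLength (proj₁ (path e)) ≤ 2 * sum (toList ℓ)
  dilated e = ℕ.≤-trans (W.shorter (proj₂ (path e))) (proj₁ (proj₂ routed) e)

  congested : ∀ e′ → Embedding.congestionAt E e′ ≤ 2 * ⌈ G.maxDegree /2⌉ * max 0 (toList ℓ)
  congested e′@(H.mkEdge u v _ u~v) = length-filter-atMost (λ e → e′ H.∈ₚ? proj₁ (path e))
    (unique-edges G)
    (atMost-mono ℕ.≤-refl
      (λ {e} on → refl , W.uses (proj₂ (path e))
        (Any.map (λ { (inj₁ (refl , refl)) → inj₁ refl ; (inj₂ (refl , refl)) → inj₂ refl }) on))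
      (proj₂ (proj₂ routed) tt {u} {v} (recompute (gridAdjacent? u v) u~v)))

theorem1 : (G : Graph) (N Δ : ℕ) → Graph.order G ≡ N → Graph.maxDegree G ≡ Δ →
    (d : ℕ) → 0 < d → (ℓ : Vec ℕ d) → All (0 <_) ℓ → N ≤ product (toList ℓ) →
    Σ[ E ∈ Embedding G (grid ℓ) ]
    (Embedding.dilation E ≤ 2 * sum (toList ℓ) ×
    Embedding.edgeCongestion E ≤ 2 * ⌈ Δ /2⌉ * max 0 (toList ℓ))
theorem1 G _ _ refl refl _ _ ℓ _ fits = embed G ℓ fits
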